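{- Let $m$ and $t$ be positive integers with $t\ge 2$, and put $$q(m,t)=\begin{cases} a(m,t/2) & \text{if } t \text{ is even},\\ a(m,(t-1)/2)+a(m-1,(t-1)/2) & \text{if } t \text{ is odd}.\end{cases}$$ If $G$ is a finite abelian group of order $n$ that contains a $t$-independent set of size $m$, then $n\ge q(m,t)$.
   Context: The numbers $a(m,s)$, for non-negative integers $m,s$, are defined recursively by $a(m,0)=a(0,s)=1$ and, for $m,s\ge 1$, $a(m,s)=a(m-1,s)+a(m,s-1)+a(m-1,s-1)$. Let $G$ be a finite abelian group written additively, $t$ a non-negative integer, and $A=\{a_1,\dots,a_m\}$ a subset of $G$ of size $m$. $A$ is a $t$-independent set in $G$ if, whenever $\lambda_1a_1+\lambda_2a_2+\cdots+\lambda_m a_m=0$ for some integers $\lambda_1,\dots,\lambda_m$ with $|\lambda_1|+|\lambda_2|+\cdots+|\lambda_m|\le t$, we have $\lambda_1=\lambda_2=\cdots=\lambda_m=0$. -}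

module Defs where

open import Algebra.Bundles using (AbelianGroup)
import Algebra.Definitions.RawMonoid as RawMonoidDefs
open import Data.Fin.Base using (Fin)
open import Data.Integer.Base using (ℤ; +_; -[1+_]; ∣_∣; 0ℤ)
open import Data.Nat.Base using (ℕ; zero; suc; _+_; _∸_; _/_; _≤_; parity; +-0-rawMonoid)
open import Data.Parity.Base using (0ℙ; 1ℙ)
open import Data.Vec.Functional using (Vector)
open import Function.Bundles using (Bijection; Injection)
open import Level using (Level; _⊔_)
open import Relation.Binary.PropositionalEquality using (_≡_; setoid)

a : ℕ → ℕ → ℕ
a zero    s       = 1
a (suc m) zero    = 1
a (suc m) (suc s) = a m (suc s) + a (suc m) s + a m s

q : ℕ → ℕ → ℕ
q m t with parity t
... | 0ℙ = a m (t / 2)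
... | 1ℙ = a m ((t ∸ 1) / 2) + a (m ∸ 1) ((t ∸ 1) / 2)

∥_∥₁ : ∀ {m} → Vector ℤ m → ℕ
∥ l ∥₁ = RawMonoidDefs.sum +-0-rawMonoid (λ i → ∣ l i ∣)

module _ {c ℓ : Level} (G : AbelianGroup c ℓ) where

  open AbelianGroup G using (Carrier; _≈_; rawMonoid)
    renaming (ε to 0#; _⁻¹ to -_; setoid to G-setoid)
  open RawMonoidDefs rawMonoid using (_×_; sum)

  HasOrder : ℕ → Set (c ⊔ ℓ)
  HasOrder n = Bijection (setoid (Fin n)) G-setoid

  infixr 8 _·_

  _·_ : ℤ → Carrier → Carrier
  (+ k)    · x = k × x
  -[1+ k ] · x = - (suc k × x)

  -- A subset of size m, presented by an enumeration a₁, …, aₘ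
  -- whose terms are pairwise distinct with respect to _≈_.
  SubsetOfSize : ℕ → Set (c ⊔ ℓ)
  SubsetOfSize m = Injection (setoid (Fin m)) G-setoid

  Independent : ℕ → ∀ {m} → SubsetOfSize m → Set ℓ
  Independent t {m} A =
    (l : Vector ℤ m) →
    sum (λ i → l i · Injection.to A i) ≈ 0# →
    ∥ l ∥₁ ≤ t →
    ∀ i → l i ≡ 0ℤ

{-# OPTIONS --safe #-}
-- Distinct coefficient vectors whose difference has ℓ¹-norm at most t give
-- distinct combinations of the elements of a t-independent set, so a family of
-- vectors with pairwise distances at most t has at most n members. For t = 2s
-- take the ball of radius s, which has a(m,s) points. For t = 2s + 1 add the
-- points of norm s + 1 with λ₁ > 0: two of these are at distance at most 2s,
-- and there are a(m-1,s) of them, since λ₁ is determined by (λ₂,…,λₘ).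

module Submission where

open import Defs
open import Algebra.Bundles using (AbelianGroup)
import Algebra.Properties.AbelianGroup as AbelianGroupProperties
import Algebra.Properties.CommutativeMonoid.Sum as Sum
import Algebra.Properties.CommutativeSemigroup as CommutativeSemigroupProperties
import Algebra.Properties.Monoid.Mult as Mult
open import Data.Fin.Base using (Fin; zero; suc)
import Data.Fin.Properties as Fin
open import Data.Integer.Base as ℤ using (ℤ; +_; -[1+_]; ∣_∣; 0ℤ; -1ℤ)
import Data.Integer.Properties as ℤ
open import Data.List.Base using (List; [_]; length; lookup; map; _++_)
open import Data.List.Membership.Propositional using (_∈_)
open import Data.List.Membership.Propositional.Properties using (∈-lookup; ∈-map⁻; ∈-++⁻)
open import Data.List.Properties using (length-++; length-map)
open import Data.List.Relation.Binary.Disjoint.Propositional using (Disjoint)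
import Data.List.Relation.Unary.All as All
open import Data.List.Relation.Unary.AllPairs using ([]; _∷_)
open import Data.List.Relation.Unary.Any using (here)
open import Data.List.Relation.Unary.Unique.Propositional using (Unique)
import Data.List.Relation.Unary.Unique.Propositional.Properties as Unique
open import Data.Nat.Base
open import Data.Nat.DivMod using (m/n*n≤m)
open import Data.Nat.Properties
open import Data.Parity.Base using (0ℙ; 1ℙ)
open import Data.Product.Base using (Σ; _,_; proj₁; proj₂)
open import Data.Sum.Base using (inj₁; inj₂)
open import Data.Vec.Base as Vec using (Vec; []; _∷_)
open import Data.Vec.Functional using (Vector)
import Data.Vec.Properties as Vec
open import Function.Base using (_∘_)
open import Function.Bundles using (Bijection; Injection)
open import Relation.Binary.PropositionalEquality
  using (_≡_; refl; sym; trans; cong; cong₂; subst)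
open import Relation.Nullary using (¬_; contradiction)

open CommutativeSemigroupProperties +-commutativeSemigroup
  using () renaming (interchange to +-interchange)

-- Integer vectors and the ℓ¹-norm.

∥_∥ : ∀ {m} → Vec ℤ m → ℕ
∥ v ∥ = ∥ Vec.lookup v ∥₁

_⊝_ : ∀ {m} → Vec ℤ m → Vec ℤ m → Vector ℤ m
(v ⊝ w) i = Vec.lookup v i ℤ.- Vec.lookup w i

∥⊝∥-≤ : ∀ {m} (v w : Vec ℤ m) → ∥ v ⊝ w ∥₁ ≤ ∥ v ∥ + ∥ w ∥
∥⊝∥-≤ []      []      = z≤n
∥⊝∥-≤ (x ∷ v) (y ∷ w) = begin
  ∣ x ℤ.- y ∣ + ∥ v ⊝ w ∥₁           ≤⟨ +-mono-≤ (ℤ.∣i-j∣≤∣i∣+∣j∣ x y) (∥⊝∥-≤ v w) ⟩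
  ∣ x ∣ + ∣ y ∣ + (∥ v ∥ + ∥ w ∥)    ≡⟨ +-interchange (∣ x ∣) (∣ y ∣) ∥ v ∥ ∥ w ∥ ⟩
  ∣ x ∣ + ∥ v ∥ + (∣ y ∣ + ∥ w ∥)    ∎
  where open ≤-Reasoning

∥0∥≡0 : ∀ m → ∥ Vec.replicate m 0ℤ ∥ ≡ 0
∥0∥≡0 zero    = refl
∥0∥≡0 (suc m) = ∥0∥≡0 m

⊝-zero⇒≡ : ∀ {m} (v w : Vec ℤ m) → (∀ i → (v ⊝ w) i ≡ 0ℤ) → v ≡ w
⊝-zero⇒≡ []      []      _    = refl
⊝-zero⇒≡ (x ∷ v) (y ∷ w) zero≡ =
  cong₂ _∷_ (ℤ.i-j≡0⇒i≡j x y (zero≡ zero)) (⊝-zero⇒≡ v w (zero≡ ∘ suc))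

-- Turns a repetition-free list into an injection from `Fin (length xs)`, the form that the
-- pigeonhole principle takes in `packing`.
lookup-injective : ∀ {a} {A : Set a} {xs : List A} → Unique xs →
  ∀ {i j} → lookup xs i ≡ lookup xs j → i ≡ j
lookup-injective (_  ∷ _) {zero}  {zero}  _  = refl
lookup-injective (x≢ ∷ _) {zero}  {suc j} eq =
  contradiction eq (All.lookup x≢ (∈-lookup j))
lookup-injective (x≢ ∷ _) {suc i} {zero}  eq =
  contradiction (sym eq) (All.lookup x≢ (∈-lookup i))
lookup-injective (_  ∷ u) {suc i} {suc j} eq = cong suc (lookup-injective u eq)

-- Enumerating the ball of radius s.

outward : ∀ {m} → Vec ℤ (suc m) → Vec ℤ (suc m)
outward (+ n      ∷ v) = + suc n ∷ v
outward (-[1+ n ] ∷ v) = -[1+ suc n ] ∷ v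

∥outward∥ : ∀ {m} (v : Vec ℤ (suc m)) → ∥ outward v ∥ ≡ suc ∥ v ∥
∥outward∥ (+ n      ∷ v) = refl
∥outward∥ (-[1+ n ] ∷ v) = refl

-- Zero moves with the positive side, to 1, while -1 moves to -2, so the images of the two sides do
-- not meet.
outward-injective : ∀ {m} {v w : Vec ℤ (suc m)} → outward v ≡ outward w → v ≡ w
outward-injective {v = + _      ∷ _} {w = + _      ∷ _} refl = refl
outward-injective {v = -[1+ _ ] ∷ _} {w = -[1+ _ ] ∷ _} refl = refl

-- Off the hyperplanes λ₁ = 0 and λ₁ = -1, every vector is uniquely the
-- image under outward of one of norm one less: this is the recursion for a.
ball : ∀ m → ℕ → List (Vec ℤ m)
ball zero    s       = [ [] ]
ball (suc m) zero    = [ Vec.replicate (suc m) 0ℤ ]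
ball (suc m) (suc s) =
  (map (0ℤ ∷_) (ball m (suc s)) ++ map outward (ball (suc m) s)) ++ map (-1ℤ ∷_) (ball m s)

length-ball : ∀ m s → length (ball m s) ≡ a m s
length-ball zero    s       = refl
length-ball (suc m) zero    = refl
length-ball (suc m) (suc s) =
  trans (length-++ (map (0ℤ ∷_) (ball m (suc s)) ++ _))
  (cong₂ _+_
    (trans (length-++ (map (0ℤ ∷_) (ball m (suc s))))
      (cong₂ _+_ (trans (length-map _ (ball m (suc s))) (length-ball m (suc s)))
                 (trans (length-map _ (ball (suc m) s)) (length-ball (suc m) s))))
    (trans (length-map _ (ball m s)) (length-ball m s)))

-- Prepending 0 keeps the norm, while `outward` and prepending -1 each add one; this matches the
-- radii `suc s`, `s` and `s` in the recursion.
ball-≤ : ∀ m s {v} → v ∈ ball m s → ∥ v ∥ ≤ s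
ball-≤ zero    s       (here refl) = z≤n
ball-≤ (suc m) zero    (here refl) = ≤-reflexive (∥0∥≡0 m)
ball-≤ (suc m) (suc s) v∈ with ∈-++⁻ (map (0ℤ ∷_) (ball m (suc s)) ++ _) v∈
... | inj₂ v∈₃ with w , w∈ , refl ← ∈-map⁻ (-1ℤ ∷_) v∈₃ = s≤s (ball-≤ m s w∈)
... | inj₁ v∈₁₂ with ∈-++⁻ (map (0ℤ ∷_) (ball m (suc s))) v∈₁₂
...   | inj₁ v∈₁ with w , w∈ , refl ← ∈-map⁻ (0ℤ ∷_) v∈₁ = ball-≤ m (suc s) w∈
...   | inj₂ v∈₂ with w , w∈ , refl ← ∈-map⁻ outward v∈₂ =
  subst (_≤ suc s) (sym (∥outward∥ w)) (s≤s (ball-≤ (suc m) s w∈))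

-- The three pieces are images under injective maps, and the first coordinate separates them: it is
-- 0, neither 0 nor -1, or -1.
ball-unique : ∀ m s → Unique (ball m s)
ball-unique zero    s       = All.[] ∷ []
ball-unique (suc m) zero    = All.[] ∷ []
ball-unique (suc m) (suc s) =
  Unique.++⁺
    (Unique.++⁺ (Unique.map⁺ Vec.∷-injectiveʳ (ball-unique m (suc s)))
                (Unique.map⁺ outward-injective (ball-unique (suc m) s))
                disjoint₁)
    (Unique.map⁺ Vec.∷-injectiveʳ (ball-unique m s))
    (disjoint₂ {ball m (suc s)})
  where
  0≢outward : ∀ {v} (w : Vec ℤ (suc m)) → ¬ (0ℤ ∷ v ≡ outward w)
  0≢outward (+ _      ∷ _) ()
  0≢outward (-[1+ _ ] ∷ _) ()

  -1≢outward : ∀ {v} (w : Vec ℤ (suc m)) → ¬ (-1ℤ ∷ v ≡ outward w)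
  -1≢outward (+ _      ∷ _) ()
  -1≢outward (-[1+ _ ] ∷ _) ()

  disjoint₁ : ∀ {xs ys} → Disjoint (map (0ℤ ∷_) xs) (map outward ys)
  disjoint₁ (v∈₁ , v∈₂) with _ , _ , refl ← ∈-map⁻ (0ℤ ∷_) v∈₁ | w , _ , eq ← ∈-map⁻ outward v∈₂ =
    0≢outward w eq

  disjoint₂ : ∀ {xs ys zs} →
    Disjoint (map (0ℤ ∷_) xs ++ map outward ys) (map (-1ℤ ∷_) zs)
  disjoint₂ {xs} (v∈₁₂ , v∈₃) with _ , _ , refl ← ∈-map⁻ (-1ℤ ∷_) v∈₃ | ∈-++⁻ (map (0ℤ ∷_) xs) v∈₁₂
  ... | inj₁ v∈₁ with _ , _ , () ← ∈-map⁻ (0ℤ ∷_) v∈₁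
  ... | inj₂ v∈₂ with w , _ , eq ← ∈-map⁻ outward v∈₂ = -1≢outward w eq

-- The ball with a cap, for odd t.

-- For ∥ v ∥ ≤ s this is the unique vector of norm s + 1 with positive first
-- coordinate and remaining coordinates v.
cap : ∀ {m} → ℕ → Vec ℤ m → Vec ℤ (suc m)
cap s v = + suc (s ∸ ∥ v ∥) ∷ v

∥cap∥ : ∀ {m s} (v : Vec ℤ m) → ∥ v ∥ ≤ s → ∥ cap s v ∥ ≡ suc s
∥cap∥ v ∥v∥≤s = cong suc (m∸n+n≡m ∥v∥≤s)

-- The triangle inequality for the whole vectors would give only 2s + 2. Both first coordinates are
-- positive, so a 1 cancels from each, and the rest regroups into two sums equal to s.
cap⊝cap-≤ : ∀ {m s} (v w : Vec ℤ m) → ∥ v ∥ ≤ s → ∥ w ∥ ≤ s →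
  ∥ cap s v ⊝ cap s w ∥₁ ≤ s + s
cap⊝cap-≤ {s = s} v w ∥v∥≤s ∥w∥≤s = begin
  ∣ suc x ℤ.⊖ suc y ∣ + ∥ v ⊝ w ∥₁   ≡⟨ cong (λ i → ∣ i ∣ + ∥ v ⊝ w ∥₁) (ℤ.[1+m]⊖[1+n]≡m⊖n x y) ⟩
  ∣ x ℤ.⊖ y ∣ + ∥ v ⊝ w ∥₁           ≤⟨ +-mono-≤ (≤-trans (ℤ.∣m⊝n∣≤m⊔n x y) (m⊔n≤m+n x y)) (∥⊝∥-≤ v w) ⟩
  x + y + (∥ v ∥ + ∥ w ∥)            ≡⟨ +-interchange x y ∥ v ∥ ∥ w ∥ ⟩
  x + ∥ v ∥ + (y + ∥ w ∥)            ≡⟨ cong₂ _+_ (m∸n+n≡m ∥v∥≤s) (m∸n+n≡m ∥w∥≤s) ⟩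
  s + s                              ∎
  where
  open ≤-Reasoning
  x = s ∸ ∥ v ∥
  y = s ∸ ∥ w ∥

cappedBall : ∀ m → ℕ → List (Vec ℤ (suc m))
cappedBall m s = ball (suc m) s ++ map (cap s) (ball m s)

length-cappedBall : ∀ m s → length (cappedBall m s) ≡ a (suc m) s + a m s
length-cappedBall m s =
  trans (length-++ (ball (suc m) s))
        (cong₂ _+_ (length-ball (suc m) s) (trans (length-map _ (ball m s)) (length-ball m s)))

-- The cap lies on the sphere of radius s + 1, hence outside the ball, and its members are told
-- apart by their tails.
cappedBall-unique : ∀ m s → Unique (cappedBall m s)
cappedBall-unique m s =
  Unique.++⁺ (ball-unique (suc m) s) (Unique.map⁺ Vec.∷-injectiveʳ (ball-unique m s)) disjoint
  where
  disjoint : Disjoint (ball (suc m) s) (map (cap s) (ball m s))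
  disjoint (v∈ , v∈′) with w , w∈ , refl ← ∈-map⁻ (cap s) v∈′ =
    1+n≰n (subst (_≤ s) (∥cap∥ w (ball-≤ m s w∈)) (ball-≤ (suc m) s v∈))

ball⊝ball-≤ : ∀ m s {v w} → v ∈ ball m s → w ∈ ball m s → ∥ v ⊝ w ∥₁ ≤ s + s
ball⊝ball-≤ m s {v} {w} v∈ w∈ =
  ≤-trans (∥⊝∥-≤ v w) (+-mono-≤ (ball-≤ m s v∈) (ball-≤ m s w∈))

-- The bound 2s + 1 comes from the mixed pairs, with norms at most s and s + 1; the other pairs stay
-- within 2s.
cappedBall⊝cappedBall-≤ : ∀ m s {v w} → v ∈ cappedBall m s → w ∈ cappedBall m s →
  ∥ v ⊝ w ∥₁ ≤ suc (s + s)
cappedBall⊝cappedBall-≤ m s {v} {w} v∈ w∈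
  with ∈-++⁻ (ball (suc m) s) v∈ | ∈-++⁻ (ball (suc m) s) w∈
... | inj₁ v∈₁ | inj₁ w∈₁ = m≤n⇒m≤1+n (ball⊝ball-≤ (suc m) s v∈₁ w∈₁)
... | inj₁ v∈₁ | inj₂ w∈₂ with w′ , w′∈ , refl ← ∈-map⁻ (cap s) w∈₂ =
  ≤-trans (∥⊝∥-≤ v w)
    (≤-trans (+-mono-≤ (ball-≤ (suc m) s v∈₁) (≤-reflexive (∥cap∥ w′ (ball-≤ m s w′∈))))
             (≤-reflexive (+-suc s s)))
... | inj₂ v∈₂ | inj₁ w∈₁ with v′ , v′∈ , refl ← ∈-map⁻ (cap s) v∈₂ =
  ≤-trans (∥⊝∥-≤ v w)
    (+-mono-≤ (≤-reflexive (∥cap∥ v′ (ball-≤ m s v′∈))) (ball-≤ (suc m) s w∈₁))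
... | inj₂ v∈₂ | inj₂ w∈₂
  with v′ , v′∈ , refl ← ∈-map⁻ (cap s) v∈₂ | w′ , w′∈ , refl ← ∈-map⁻ (cap s) w∈₂ =
  m≤n⇒m≤1+n (cap⊝cap-≤ v′ w′ (ball-≤ m s v′∈) (ball-≤ m s w′∈))

-- Integer combinations in an abelian group, and the packing bound.

module _ {c ℓ} (G : AbelianGroup c ℓ) where

  open AbelianGroup G hiding (refl; sym; trans)
  module ≈ = AbelianGroup G
  open AbelianGroupProperties G
  open CommutativeSemigroupProperties commutativeSemigroup using (interchange)
  open Sum commutativeMonoid using (sum; sum-cong-≋; ∑-distrib-+)
  open Mult monoid using (_×_; ×-homo-+)
  open import Relation.Binary.Reasoning.Setoid setoid

  infixr 8 _⊙_
  _⊙_ : ℤ → Carrier → Carrier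
  _⊙_ = _·_ G

  ⊙-neg : ∀ i x → (ℤ.- i) ⊙ x ≈ (i ⊙ x) ⁻¹
  ⊙-neg (+ zero)   x = ≈.sym ε⁻¹≈ε
  ⊙-neg (+ suc n)  x = ≈.refl
  ⊙-neg (-[1+ n ]) x = ≈.sym (⁻¹-involutive _)

  -- Integers of opposite sign add up to a `⊖` by computation, so this is the mixed case of
  -- `⊙-homo-+`.
  ⊙-⊖ : ∀ m n x → (m ℤ.⊖ n) ⊙ x ≈ m × x - n × x
  ⊙-⊖ zero    zero    x = ≈.sym (inverseʳ ε)
  ⊙-⊖ zero    (suc n) x = ≈.sym (identityˡ _)
  ⊙-⊖ (suc m) zero    x = ≈.sym (≈.trans (∙-congˡ ε⁻¹≈ε) (identityʳ _))
  ⊙-⊖ (suc m) (suc n) x = begin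
    (suc m ℤ.⊖ suc n) ⊙ x                ≡⟨ cong (_⊙ x) (ℤ.[1+m]⊖[1+n]≡m⊖n m n) ⟩
    (m ℤ.⊖ n) ⊙ x                        ≈⟨ ⊙-⊖ m n x ⟩
    m × x - n × x                        ≈⟨ identityˡ _ ⟨
    ε ∙ (m × x - n × x)                  ≈⟨ ∙-congʳ (inverseʳ x) ⟨
    (x - x) ∙ (m × x - n × x)            ≈⟨ interchange _ _ _ _ ⟩
    (x ∙ m × x) ∙ (x ⁻¹ ∙ (n × x) ⁻¹)    ≈⟨ ∙-congˡ (⁻¹-∙-comm x (n × x)) ⟩
    (x ∙ m × x) - (x ∙ n × x)            ∎

  ⊙-homo-+ : ∀ i j x → (i ℤ.+ j) ⊙ x ≈ i ⊙ x ∙ j ⊙ x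
  ⊙-homo-+ (+ m)      (+ n)      x = ×-homo-+ x m n
  ⊙-homo-+ (+ m)      (-[1+ n ]) x = ⊙-⊖ m (suc n) x
  ⊙-homo-+ (-[1+ m ]) (+ n)      x = ≈.trans (⊙-⊖ n (suc m) x) (comm _ _)
  ⊙-homo-+ (-[1+ m ]) (-[1+ n ]) x = begin
    (suc (suc (m + n)) × x) ⁻¹             ≡⟨ cong (λ k → (suc k × x) ⁻¹) (+-suc m n) ⟨
    ((suc m + suc n) × x) ⁻¹               ≈⟨ ⁻¹-cong (×-homo-+ x (suc m) (suc n)) ⟩
    (suc m × x ∙ suc n × x) ⁻¹             ≈⟨ ⁻¹-∙-comm _ _ ⟨
    (suc m × x) ⁻¹ ∙ (suc n × x) ⁻¹        ∎

  module _ {m : ℕ} (g : Fin m → Carrier) where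

    combination : Vec ℤ m → Carrier
    combination v = sum λ i → Vec.lookup v i ⊙ g i

    -- Adding `combination w` to both sides reduces the claim to the termwise identity `cancel` and
    -- the additivity of sums.
    combination-⊝ : ∀ v w → combination v ≈ combination w →
      sum (λ i → (v ⊝ w) i ⊙ g i) ≈ ε
    combination-⊝ v w v≈w = ∙-cancelʳ (combination w) _ _ (begin
      sum (λ i → (v ⊝ w) i ⊙ g i) ∙ combination w   ≈⟨ ∑-distrib-+ _ (λ i → Vec.lookup w i ⊙ g i) ⟨
      sum (λ i → (v ⊝ w) i ⊙ g i ∙ Vec.lookup w i ⊙ g i)
                                                    ≈⟨ sum-cong-≋ (λ i → cancel (Vec.lookup v i) (Vec.lookup w i) (g i)) ⟩
      combination v                                 ≈⟨ v≈w ⟩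
      combination w                                 ≈⟨ identityˡ _ ⟨
      ε ∙ combination w                             ∎)
      where
      cancel : ∀ i j x → (i ℤ.- j) ⊙ x ∙ j ⊙ x ≈ i ⊙ x
      cancel i j x = begin
        (i ℤ.- j) ⊙ x ∙ j ⊙ x               ≈⟨ ∙-congʳ (⊙-homo-+ i (ℤ.- j) x) ⟩
        (i ⊙ x ∙ (ℤ.- j) ⊙ x) ∙ j ⊙ x       ≈⟨ ∙-congʳ (∙-congˡ (⊙-neg j x)) ⟩
        (i ⊙ x - j ⊙ x) ∙ j ⊙ x             ≈⟨ //-rightDividesˡ (j ⊙ x) (i ⊙ x) ⟩
        i ⊙ x                               ∎

  -- Label each vector by an index of its combination in G. Vectors with equal labels differ by a
  -- relation of norm at most t, which independence makes zero.
  packing : ∀ {m n t} → HasOrder G n →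
    (A : SubsetOfSize G m) → Independent G t A →
    (xs : List (Vec ℤ m)) → Unique xs →
    (∀ {v w} → v ∈ xs → w ∈ xs → ∥ v ⊝ w ∥₁ ≤ t) →
    length xs ≤ n
  packing {m} {n} order A indep xs unique close = Fin.injective⇒≤ {f = label} label-injective
    where
    open Bijection order using (to; surjective)

    g : Fin m → Carrier
    g = Injection.to A

    point : Fin (length xs) → Carrier
    point i = combination g (lookup xs i)

    label : Fin (length xs) → Fin n
    label i = proj₁ (surjective (point i))

    to-label : ∀ i → to (label i) ≈ point i
    -- Surjectivity speaks of every index equal to the witness; `refl` selects the witness itself.
    to-label i = proj₂ (surjective (point i)) refl

    label-injective : ∀ {i j} → label i ≡ label j → i ≡ j
    label-injective {i} {j} eq = lookup-injective unique (⊝-zero⇒≡ v w (indep (v ⊝ w)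
      (combination-⊝ g v w (begin
        point i       ≈⟨ to-label i ⟨
        to (label i)  ≡⟨ cong to eq ⟩
        to (label j)  ≈⟨ to-label j ⟩
        point j       ∎))
      (close (∈-lookup i) (∈-lookup j))))
      where
      v = lookup xs i
      w = lookup xs j

-- Halving t, and the bound for both parities.

[n/2]+[n/2]≤n : ∀ n → n / 2 + n / 2 ≤ n
[n/2]+[n/2]≤n n = begin
  n / 2 + n / 2        ≡⟨ cong (_+_ (n / 2)) (+-identityʳ (n / 2)) ⟨
  2 * (n / 2)          ≡⟨ *-comm 2 (n / 2) ⟩
  n / 2 * 2            ≤⟨ m/n*n≤m n 2 ⟩
  n                    ∎
  where open ≤-Reasoning

theorem10 : ∀ {c ℓ} (m t : ℕ) → 1 ≤ m → 2 ≤ t →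
    (G : AbelianGroup c ℓ) (n : ℕ) → HasOrder G n →
    Σ (SubsetOfSize G m) (λ A → Independent G t A) →
    n ≥ q m t
theorem10 (suc m) (suc t) _ _ G n order (A , indep) with parity (suc t)
... | 0ℙ = subst (_≤ n) (length-ball (suc m) s)
  (packing G order A indep (ball (suc m) s) (ball-unique (suc m) s)
    (λ v∈ w∈ → ≤-trans (ball⊝ball-≤ (suc m) s v∈ w∈) ([n/2]+[n/2]≤n (suc t))))
  where s = suc t / 2
-- Here `suc t ∸ 1` computes to `t`, so s is `t / 2`, and 2s ≤ t gives the allowed distance 2s + 1 ≤
-- `suc t`.
... | 1ℙ = subst (_≤ n) (length-cappedBall m s)
  (packing G order A indep (cappedBall m s) (cappedBall-unique m s)
    (λ v∈ w∈ → ≤-trans (cappedBall⊝cappedBall-≤ m s v∈ w∈) (s≤s ([n/2]+[n/2]≤n t))))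
  where s = t / 2
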